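{- Let $T$ be a monoidal monad on $\mathbf{Set}$, let $\Sigma$ be a signature and $\cdot\in\Sigma$ a binary operation symbol. Let $t[-]$ be a $\Sigma$-term with a single hole, built only from binary operation symbols of $\Sigma$, in which no variable occurs more than once and the variable $x$ does not occur. If $T$ preserves the equation $t[x]=t[x\cdot x]$, then $T$ is relevant.
   Context: $t[N]$ denotes the term obtained by placing the term $N$ in the hole of $t$. A monoidal monad on $\mathbf{Set}$ is a monad with natural $\psi_{X,Y}\colon TX\times TY\to T(X\times Y)$ making it lax monoidal with $\psi^0=\eta_1$ and with $\eta,\mu$ monoidal (equivalently a commutative monad); $\psi^n$ is its $n$-ary version. The lifting $\widehat T\mathcal A$ of a $\Sigma$-algebra $\mathcal A$ on $A$ has carrier $TA$ and operations $T\sigma_{\mathcal A}\circ\psi^{\mathrm{ar}(\sigma)}$; $T$ preserves an equation if $\widehat T\mathcal A$ satisfies it whenever $\mathcal A$ does. $T$ is relevant if $\psi_{A,B}\circ\langle T\pi_1,T\pi_2\rangle=\mathrm{id}_{T(A\times B)}$ for all sets $A,B$ (equivalently $\psi_{A,A}\circ\Delta_{TA}=T\Delta_A$ for all $A$). -}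

module Defs where

open import Data.List.Base as List using (List)
open import Data.Maybe.Base using (Maybe; maybe′)
open import Data.Nat.Base using (ℕ)
open import Data.Product.Base as Product using (_×_; _,_; proj₁; proj₂; uncurry; assocʳ′)
open import Data.Unit.Polymorphic.Base using (tt)
open import Data.Vec.Base using (Vec; []; _∷_)
open import Function.Base using (_∘_; id)
open import Level using (Level; _⊔_)
open import Relation.Binary.PropositionalEquality using (_≡_; _≗_)

private
  variable
    ℓ o v w : Level

-- Equality of functions is pointwise throughout; since function
-- extensionality is not available, `map-cong` must be required explicitly.
record Monad (ℓ : Level) : Set (Level.suc ℓ) where
  field
    T   : Set ℓ → Set ℓ
    map : ∀ {X Y} → (X → Y) → T X → T Y
    η   : ∀ {X} → X → T X
    μ   : ∀ {X} → T (T X) → T X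

    map-cong : ∀ {X Y} {f g : X → Y} → f ≗ g → map f ≗ map g
    map-id   : ∀ {X} → map (id {A = X}) ≗ id
    map-∘    : ∀ {X Y Z} (g : Y → Z) (f : X → Y) → map (g ∘ f) ≗ map g ∘ map f

    η-natural : ∀ {X Y} (f : X → Y) → map f ∘ η ≗ η ∘ f
    μ-natural : ∀ {X Y} (f : X → Y) → map f ∘ μ ≗ μ ∘ map (map f)

    μ-identityˡ : ∀ {X} → μ {X} ∘ η ≗ id
    μ-identityʳ : ∀ {X} → μ {X} ∘ map η ≗ id
    μ-assoc     : ∀ {X} → μ {X} ∘ μ ≗ μ ∘ map μ

-- The nullary structure map ψ⁰ : 1 → T 1 is η at the one-element type.  This
-- makes the nullary halves of "η and μ are monoidal" consequences of the
-- monad laws, so only the binary halves appear as fields.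
record MonoidalMonad (ℓ : Level) : Set (Level.suc ℓ) where
  field
    monad : Monad ℓ

  open Monad monad public

  field
    ψ : ∀ {X Y} → T X × T Y → T (X × Y)

    ψ-natural : ∀ {X X′ Y Y′} (f : X → X′) (g : Y → Y′) →
                map (Product.map f g) ∘ ψ ≗ ψ ∘ Product.map (map f) (map g)

    ψ-assoc : ∀ {X Y Z} →
              map assocʳ′ ∘ ψ {X × Y} {Z} ∘ Product.map ψ id
                ≗ ψ ∘ Product.map id ψ ∘ assocʳ′

    ψ-identityˡ : ∀ {Y} (u : T Y) → map proj₂ (ψ (η tt , u)) ≡ u
    ψ-identityʳ : ∀ {X} (u : T X) → map proj₁ (ψ (u , η tt)) ≡ u

    η-monoidal : ∀ {X Y} → ψ {X} {Y} ∘ Product.map η η ≗ η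
    μ-monoidal : ∀ {X Y} → ψ {X} {Y} ∘ Product.map μ μ ≗ μ ∘ map ψ ∘ ψ

  ψⁿ : ∀ {X n} → Vec (T X) n → T (Vec X n)
  ψⁿ []       = η []
  ψⁿ (u ∷ us) = map (uncurry _∷_) (ψ (u , ψⁿ us))

Relevant : MonoidalMonad ℓ → Set (Level.suc ℓ)
Relevant {ℓ} 𝕋 = ∀ {A B : Set ℓ} (u : T (A × B)) → ψ (map proj₁ u , map proj₂ u) ≡ u
  where open MonoidalMonad 𝕋

-- A signature is presented as the family of its symbols graded by arity.
record Signature (o : Level) : Set (Level.suc o) where
  field
    Op : ℕ → Set o

open Signature public

data Term (Σ : Signature o) (V : Set v) : Set (o ⊔ v) where
  var : V → Term Σ V
  op  : ∀ {n} → Op Σ n → Vec (Term Σ V) n → Term Σ V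

module _ {Σ : Signature o} where

  app₂ : {V : Set v} → Op Σ 2 → Term Σ V → Term Σ V → Term Σ V
  app₂ σ s t = op σ (s ∷ t ∷ [])

  module _ {V : Set v} {W : Set w} (ρ : V → Term Σ W) where

    substitute  : Term Σ V → Term Σ W
    substitutes : ∀ {n} → Vec (Term Σ V) n → Vec (Term Σ W) n

    substitute (var y)   = ρ y
    substitute (op σ ts) = op σ (substitutes ts)

    substitutes []       = []
    substitutes (t ∷ ts) = substitute t ∷ substitutes ts

  -- All occurrences, from left to right, with repetitions.
  variables  : {V : Set v} → Term Σ V → List V
  variables* : ∀ {V : Set v} {n} → Vec (Term Σ V) n → List V

  variables (var y)   = List.[ y ]
  variables (op σ ts) = variables* ts

  variables* []       = List.[]
  variables* (t ∷ ts) = variables t List.++ variables* ts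

  data BinaryOnly {V : Set v} : Term Σ V → Set (o ⊔ v) where
    var : (y : V) → BinaryOnly (var y)
    op₂ : (σ : Op Σ 2) {s t : Term Σ V} →
          BinaryOnly s → BinaryOnly t → BinaryOnly (app₂ σ s t)

Var : Set
Var = ℕ

-- Terms with holes: `var nothing` is a hole, `var (just y)` the variable y.
HoleTerm : Signature o → Set o
HoleTerm Σ = Term Σ (Maybe Var)

module _ {Σ : Signature o} where

  _[_] : HoleTerm Σ → Term Σ Var → Term Σ Var
  t [ N ] = substitute (maybe′ var N) t

record Algebra (Σ : Signature o) (ℓ : Level) : Set (o ⊔ Level.suc ℓ) where
  field
    Carrier : Set ℓ
    ⟦_⟧     : ∀ {n} → Op Σ n → Vec Carrier n → Carrier

module _ {Σ : Signature o} (𝒜 : Algebra Σ ℓ) where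
  open Algebra 𝒜

  module _ {V : Set v} (ρ : V → Carrier) where

    eval  : Term Σ V → Carrier
    evals : ∀ {n} → Vec (Term Σ V) n → Vec Carrier n

    eval (var y)   = ρ y
    eval (op σ ts) = ⟦ σ ⟧ (evals ts)

    evals []       = []
    evals (t ∷ ts) = eval t ∷ evals ts

infix 4 _⊨_≈_

_⊨_≈_ : {Σ : Signature o} → Algebra Σ ℓ → Term Σ Var → Term Σ Var → Set ℓ
𝒜 ⊨ s ≈ t = (ρ : Var → Algebra.Carrier 𝒜) → eval 𝒜 ρ s ≡ eval 𝒜 ρ t

lifting : {Σ : Signature o} → MonoidalMonad ℓ → Algebra Σ ℓ → Algebra Σ ℓ
lifting 𝕋 𝒜 = record
  { Carrier = T Carrier
  ; ⟦_⟧     = λ σ → map ⟦ σ ⟧ ∘ ψⁿ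
  }
  where
  open MonoidalMonad 𝕋
  open Algebra 𝒜

Preserves : {Σ : Signature o} → MonoidalMonad ℓ → Term Σ Var → Term Σ Var → Set (o ⊔ Level.suc ℓ)
Preserves {ℓ = ℓ} {Σ = Σ} 𝕋 s t = (𝒜 : Algebra Σ ℓ) → 𝒜 ⊨ s ≈ t → lifting 𝕋 𝒜 ⊨ s ≈ t

{-# OPTIONS --safe #-}
-- If t is the bare hole, then t[x] = t[x · x] holds in every rectangular band
-- (a , b) · (a′ , b′) = (a , b′) on A × B, and idempotence of the lifted
-- operation on T (A × B) is precisely relevance.  A deeper hole, at the end of
-- a path ws of left and right turns, is handled by delaying the band by
-- |ws| steps: on (A × B)^(1+|ws|) the entries above the last are shifted up from
-- the argument selected by the corresponding turn, while the last one is
-- multiplied in the band.  Differences between x and x · x occur above the last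
-- entry only, and each operation on the way to the root shifts them up by one,
-- so that they are gone at the root.  On the other hand the first
-- entry of t[x] is the last entry of x, so that t[-] loses no information.
module Submission where

open import Defs
open import Level using (Level)
open import Data.Empty using (⊥-elim)
open import Data.List.Base using (List; []; _∷_; _++_; length)
open import Data.List.Properties using (++-identityʳ)
open import Data.List.Relation.Unary.All as All using ()
open import Data.List.Relation.Unary.All.Properties using (++⁻ˡ)
open import Data.List.Relation.Unary.AllPairs using ([]; _∷_)
open import Data.List.Relation.Unary.Any using (here; there)
open import Data.List.Membership.Propositional.Properties using (∈-++⁺ˡ; ∈-++⁺ʳ; ∈-++⁻)
open import Data.Maybe.Base using (just; nothing; maybe′; zipWith)
open import Data.Nat.Base using (ℕ; zero; suc; _+_)
open import Data.Nat.Properties using (_≟_; +-identityʳ; +-suc)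
open import Data.Product.Base as Product using (∃; _,_; proj₁; proj₂; uncurry)
open import Data.Sum.Base using (inj₁; inj₂)
open import Data.Unit.Polymorphic.Base using (⊤; tt)
open import Data.Vec.Base using (Vec; []; _∷_; head; tail; replicate)
open import Function.Base using (_∘_; id; const)
open import Relation.Binary.PropositionalEquality
  using (_≡_; _≢_; refl; sym; trans; cong; cong₂; subst; module ≡-Reasoning)
open import Relation.Nullary using (yes; no)
open import Data.List.Membership.Propositional using (_∈_; _∉_)
open import Data.List.Relation.Unary.Unique.Propositional using (Unique)

open ≡-Reasoning

private
  variable
    ℓ o : Level

-- Lists without repetition

module _ {A : Set ℓ} where

  Unique-++⁻ˡ : ∀ (xs : List A) {ys} → Unique (xs ++ ys) → Unique xs
  Unique-++⁻ˡ []       _           = []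
  Unique-++⁻ˡ (x ∷ xs) (x∉ ∷ uniq) = ++⁻ˡ xs x∉ ∷ Unique-++⁻ˡ xs uniq

  Unique-++⁻ʳ : ∀ (xs : List A) {ys} → Unique (xs ++ ys) → Unique ys
  Unique-++⁻ʳ []       uniq       = uniq
  Unique-++⁻ʳ (x ∷ xs) (_ ∷ uniq) = Unique-++⁻ʳ xs uniq

  Unique-++-disjoint : ∀ (xs : List A) {ys z} → Unique (xs ++ ys) → z ∈ xs → z ∉ ys
  Unique-++-disjoint (x ∷ xs) (x∉ ∷ _)   (here refl)  z∈ys = All.lookup x∉ (∈-++⁺ʳ xs z∈ys) refl
  Unique-++-disjoint (x ∷ xs) (_ ∷ uniq) (there z∈xs) z∈ys = Unique-++-disjoint xs uniq z∈xs z∈ys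

-- Contexts with one hole

data Side : Set where
  left right : Side

pick : {A : Set ℓ} → Side → A → A → A
pick left  a b = a
pick right a b = b

module _ {Σ : Signature o} (x : Var) where

  data Fresh : HoleTerm Σ → Set o where
    var : ∀ {y} → y ≢ x → Fresh (var (just y))
    op₂ : ∀ σ {s t} → Fresh s → Fresh t → Fresh (app₂ σ s t)

  -- The index lists the turns from the root down to the hole; whatever branches off this path is
  -- fresh.
  data Linear : HoleTerm Σ → List Side → Set o where
    hole   : Linear (var nothing) []
    leftᵒ  : ∀ σ {s t ws} → Linear s ws → Fresh t → Linear (app₂ σ s t) (left ∷ ws)
    rightᵒ : ∀ σ {s t ws} → Fresh s → Linear t ws → Linear (app₂ σ s t) (right ∷ ws)

  fresh : ∀ {t} → BinaryOnly t → nothing ∉ variables t → just x ∉ variables t → Fresh t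
  fresh (var nothing)  ∉∙ ∉x = ⊥-elim (∉∙ (here refl))
  fresh (var (just y)) ∉∙ ∉x = var λ { refl → ∉x (here refl) }
  fresh (op₂ σ {s} {t} bs bt) ∉∙ ∉x rewrite ++-identityʳ (variables t) =
    op₂ σ (fresh bs (∉∙ ∘ ∈-++⁺ˡ) (∉x ∘ ∈-++⁺ˡ))
          (fresh bt (∉∙ ∘ ∈-++⁺ʳ (variables s)) (∉x ∘ ∈-++⁺ʳ (variables s)))

  -- The hole counts among the variables as `nothing`, so uniqueness keeps it out of the sibling of
  -- any subterm that contains it.
  linear : ∀ {t} → BinaryOnly t → nothing ∈ variables t → Unique (variables t) →
           just x ∉ variables t → ∃ (Linear t)
  linear (var nothing)  _ _ _ = [] , hole
  linear (var (just y)) (here ()) _ _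
  linear (op₂ σ {s} {t} bs bt) ∈∙ uniq ∉x rewrite ++-identityʳ (variables t)
    with ∈-++⁻ (variables s) ∈∙
  ... | inj₁ ∈s =
    Product.map (left ∷_)
      (λ ls → leftᵒ σ ls (fresh bt (Unique-++-disjoint (variables s) uniq ∈s)
                                   (∉x ∘ ∈-++⁺ʳ (variables s))))
      (linear bs ∈s (Unique-++⁻ˡ (variables s) uniq) (∉x ∘ ∈-++⁺ˡ))
  ... | inj₂ ∈t =
    Product.map (right ∷_)
      (rightᵒ σ (fresh bs (λ ∈s → Unique-++-disjoint (variables s) uniq ∈s ∈t)
                          (∉x ∘ ∈-++⁺ˡ)))
      (linear bt ∈t (Unique-++⁻ʳ (variables s) uniq) (∉x ∘ ∈-++⁺ʳ (variables s)))

  fresh-plug : ∀ {t} → Fresh t → ∀ M N → t [ M ] ≡ t [ N ]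
  fresh-plug (var _)       M N = refl
  fresh-plug (op₂ σ fs ft) M N = cong₂ (app₂ σ) (fresh-plug fs M N) (fresh-plug ft M N)

-- Delaying a binary operation along a path

module Delay {P : Set ℓ} (_∙_ : P → P → P) where

  Chain : List Side → Set ℓ
  Chain ws = Vec P (suc (length ws))

  product : ∀ ws → Chain ws → Chain ws → Chain ws
  product []       c d = (head c ∙ head d) ∷ []
  product (w ∷ ws) c d = head (pick w (tail c) (tail d)) ∷ product ws (tail c) (tail d)

  bottom : ∀ ws → Chain ws → P
  bottom []       c = head c
  bottom (w ∷ ws) c = bottom ws (tail c)

  constant : ∀ ws → P → Chain ws
  constant ws p = replicate _ p

  bottom-product : ∀ ws c d → bottom ws (product ws c d) ≡ bottom ws c ∙ bottom ws d
  bottom-product []       c d = refl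
  bottom-product (w ∷ ws) c d = bottom-product ws (tail c) (tail d)

  bottom-constant : ∀ ws p → bottom ws (constant ws p) ≡ p
  bottom-constant []       p = refl
  bottom-constant (w ∷ ws) p = bottom-constant ws p

  product-constant : ∀ {p} → p ∙ p ≡ p → ∀ ws →
                     product ws (constant ws p) (constant ws p) ≡ constant ws p
  product-constant pp []           = cong (_∷ []) pp
  product-constant pp (left  ∷ ws) = cong (_ ∷_) (product-constant pp ws)
  product-constant pp (right ∷ ws) = cong (_ ∷_) (product-constant pp ws)

  -- Agreement from entry k on; the last entry is always included.
  AgreeFrom : ∀ ws → ℕ → Chain ws → Chain ws → Set ℓ
  AgreeFrom ws       zero    c d = c ≡ d
  AgreeFrom []       (suc k) c d = c ≡ d
  AgreeFrom (w ∷ ws) (suc k) c d = AgreeFrom ws k (tail c) (tail d)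

  agree-square : (∀ p → p ∙ p ≡ p) → ∀ ws c → AgreeFrom ws (length ws) c (product ws c c)
  agree-square idem []       (p ∷ []) = cong (_∷ []) (sym (idem p))
  agree-square idem (w ∷ ws) c        = agree-square idem ws (tail c)

  -- An entry of the product above the last depends only on the next entry of a factor, and the last
  -- only on the last. For `k` zero and a nonempty path, the product uses `c` only through its tail.
  agree-productˡ : ∀ ws k {c c′} d → AgreeFrom ws (suc k) c c′ →
                   AgreeFrom ws k (product ws c d) (product ws c′ d)
  agree-productˡ []       zero    d refl = refl
  agree-productˡ []       (suc k) d refl = refl
  agree-productˡ (w ∷ ws) zero    d eq   =
    cong (λ e → head (pick w e (tail d)) ∷ product ws e (tail d)) eq
  agree-productˡ (w ∷ ws) (suc k) d eq   = agree-productˡ ws k (tail d) eq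

  agree-productʳ : ∀ ws k c {d d′} → AgreeFrom ws (suc k) d d′ →
                   AgreeFrom ws k (product ws c d) (product ws c d′)
  agree-productʳ []       zero    c refl = refl
  agree-productʳ []       (suc k) c refl = refl
  agree-productʳ (w ∷ ws) zero    c eq   =
    cong (λ e → head (pick w (tail c) e) ∷ product ws (tail c) e) eq
  agree-productʳ (w ∷ ws) (suc k) c eq   = agree-productʳ ws k (tail c) eq

  module _ (⋆ : P) where

    -- The context with hole at the end of the path ws, evaluated in the
    -- algebra delayed along vs, with all variables interpreted as ⋆.
    fill : ∀ vs → List Side → Chain vs → Chain vs
    fill vs []           c = c
    fill vs (left  ∷ ws) c = product vs (fill vs ws c) (constant vs ⋆)
    fill vs (right ∷ ws) c = product vs (constant vs ⋆) (fill vs ws c)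

    -- `tail` is a homomorphism from the operation delayed along `v ∷ vs` to the one delayed along
    -- `vs`, and it preserves constants.
    tail-fill : ∀ v vs ws c → tail (fill (v ∷ vs) ws c) ≡ fill vs ws (tail c)
    tail-fill v vs []           c = refl
    tail-fill v vs (left  ∷ ws) c = cong (λ d → product vs d (constant vs ⋆)) (tail-fill v vs ws c)
    tail-fill v vs (right ∷ ws) c = cong (product vs (constant vs ⋆)) (tail-fill v vs ws c)

    -- When the delay follows the path of the hole itself, each turn selects the argument that
    -- contains the hole, so the head is fetched one entry deeper at each level, down to the last.
    head-fill : ∀ ws c → head (fill ws ws c) ≡ bottom ws c
    head-fill []           c = refl
    head-fill (left  ∷ ws) c = trans (cong head (tail-fill left ws ws c)) (head-fill ws (tail c))
    head-fill (right ∷ ws) c = trans (cong head (tail-fill right ws ws c)) (head-fill ws (tail c))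

    interpret : ∀ ws {n} → Vec (Chain ws) n → Chain ws
    interpret ws (c ∷ d ∷ []) = product ws c d
    interpret ws _            = constant ws ⋆

    -- All binary symbols are interpreted alike, since symbols cannot be
    -- compared; symbols of other arities do not matter.
    delayed : (Σ : Signature o) → List Side → Algebra Σ ℓ
    delayed Σ ws = record { Carrier = Chain ws ; ⟦_⟧ = λ _ → interpret ws }

    module _ {Σ : Signature o} {x : Var} (vs : List Side) (ρ : Var → Chain vs) {M N : Term Σ Var} where

      private
        ⟦_⟧ᵛ : Term Σ Var → Chain vs
        ⟦_⟧ᵛ = eval (delayed Σ vs) ρ

      -- The offset `k` is the number of operations still above the current subterm when the
      -- outermost call has offset 0; descending one turn moves a unit from `length ws` to `k`.
      agree-plug : ∀ {t ws} → Linear x t ws → ∀ k →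
                   AgreeFrom vs (k + length ws) ⟦ M ⟧ᵛ ⟦ N ⟧ᵛ →
                   AgreeFrom vs k ⟦ t [ M ] ⟧ᵛ ⟦ t [ N ] ⟧ᵛ
      agree-plug hole k eq = subst (λ j → AgreeFrom vs j ⟦ M ⟧ᵛ ⟦ N ⟧ᵛ) (+-identityʳ k) eq
      -- The rewrite makes the sibling the same on both sides, so that only one factor varies.
      agree-plug (leftᵒ σ {s} {t} {ws} ls ft) k eq rewrite fresh-plug x ft M N =
        agree-productˡ vs k ⟦ t [ N ] ⟧ᵛ
          (agree-plug ls (suc k) (subst (λ j → AgreeFrom vs j ⟦ M ⟧ᵛ ⟦ N ⟧ᵛ) (+-suc k (length ws)) eq))
      agree-plug (rightᵒ σ {s} {t} {ws} fs lt) k eq rewrite fresh-plug x fs M N =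
        agree-productʳ vs k ⟦ s [ N ] ⟧ᵛ
          (agree-plug lt (suc k) (subst (λ j → AgreeFrom vs j ⟦ M ⟧ᵛ ⟦ N ⟧ᵛ) (+-suc k (length ws)) eq))

    delayed-⊨ : (∀ p → p ∙ p ≡ p) → ∀ {Σ : Signature o} (τ : Op Σ 2) {x t ws} → Linear x t ws →
                delayed Σ ws ⊨ t [ var x ] ≈ t [ app₂ τ (var x) (var x) ]
    -- Agreement from entry 0 is equality of chains.
    delayed-⊨ idem τ {x} {ws = ws} lt ρ = agree-plug ws ρ lt 0 (agree-square idem ws (ρ x))

-- Lifted binary functions

module _ (𝕋 : MonoidalMonad ℓ) where

  open MonoidalMonad 𝕋

  private
    variable
      A B C D : Set ℓ

  map-just-injective : {u v : T A} → map just u ≡ map just v → u ≡ v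
  map-just-injective {u = u} {v} eq = begin
    u                                 ≡⟨ retraction u ⟨
    μ (map (maybe′ η u) (map just u)) ≡⟨ cong (μ ∘ map (maybe′ η u)) eq ⟩
    μ (map (maybe′ η u) (map just v)) ≡⟨ retraction v ⟩
    v                                 ∎
    where
    -- Kleisli extension, with u itself as junk value for nothing: the
    -- underlying set may be empty.
    retraction : ∀ w → μ (map (maybe′ η u) (map just w)) ≡ w
    retraction w = trans (cong μ (sym (map-∘ (maybe′ η u) just w))) (μ-identityʳ w)

  -- Reduces a pure argument of `ψ` to `η tt`, where the unit laws apply.
  η-const : ∀ (b : B) → η b ≡ map (const b) (η {X = ⊤} tt)
  η-const b = sym (η-natural (const b) tt)

  ψ-ηʳ : ∀ (u : T A) (b : B) → ψ (u , η b) ≡ map (_, b) u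
  ψ-ηʳ u b = begin
    ψ (u , η b)                                   ≡⟨ cong₂ (λ v w → ψ (v , w)) (sym (map-id u)) (η-const b) ⟩
    ψ (map id u , map (const b) (η tt))           ≡⟨ ψ-natural id (const b) (u , η tt) ⟨
    map (Product.map id (const b)) (ψ (u , η tt)) ≡⟨ map-∘ (_, b) proj₁ _ ⟩
    map (_, b) (map proj₁ (ψ (u , η tt)))         ≡⟨ cong (map (_, b)) (ψ-identityʳ u) ⟩
    map (_, b) u                                  ∎

  ψ-ηˡ : ∀ (a : A) (u : T B) → ψ (η a , u) ≡ map (a ,_) u
  ψ-ηˡ a u = begin
    ψ (η a , u)                                   ≡⟨ cong₂ (λ v w → ψ (v , w)) (η-const a) (sym (map-id u)) ⟩
    ψ (map (const a) (η tt) , map id u)           ≡⟨ ψ-natural (const a) id (η tt , u) ⟨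
    map (Product.map (const a) id) (ψ (η tt , u)) ≡⟨ map-∘ (a ,_) proj₂ _ ⟩
    map (a ,_) (map proj₂ (ψ (η tt , u)))         ≡⟨ cong (map (a ,_)) (ψ-identityˡ u) ⟩
    map (a ,_) u                                  ∎

  lift₂ : (A → B → C) → T A → T B → T C
  lift₂ f u v = map (uncurry f) (ψ (u , v))

  lift₂-ηʳ : ∀ (f : A → B → C) u b → lift₂ f u (η b) ≡ map (λ a → f a b) u
  lift₂-ηʳ f u b = trans (cong (map (uncurry f)) (ψ-ηʳ u b)) (sym (map-∘ (uncurry f) (_, b) u))

  lift₂-ηˡ : ∀ (f : A → B → C) a v → lift₂ f (η a) v ≡ map (f a) v
  lift₂-ηˡ f a v = trans (cong (map (uncurry f)) (ψ-ηˡ a v)) (sym (map-∘ (uncurry f) (a ,_) v))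

  map-lift₂ : ∀ (g : C → D) (f : A → B → C) u v →
              map g (lift₂ f u v) ≡ lift₂ (λ a b → g (f a b)) u v
  map-lift₂ g f u v = sym (map-∘ g (uncurry f) _)

  lift₂-map : ∀ {A′ B′ : Set ℓ} (f : A → B → C) (g : A′ → A) (h : B′ → B) u v →
              lift₂ f (map g u) (map h v) ≡ lift₂ (λ a b → f (g a) (h b)) u v
  lift₂-map f g h u v =
    trans (cong (map (uncurry f)) (sym (ψ-natural g h (u , v))))
          (sym (map-∘ (uncurry f) (Product.map g h) _))

  lift₂-cong : ∀ {f g : A → B → C} → (∀ a b → f a b ≡ g a b) → ∀ u v → lift₂ f u v ≡ lift₂ g u v
  lift₂-cong eq u v = map-cong (uncurry eq) _

  map-ψⁿ₂ : ∀ (f : Vec A 2 → B) u v →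
            map f (ψⁿ (u ∷ v ∷ [])) ≡ lift₂ (λ a b → f (a ∷ b ∷ [])) u v
  map-ψⁿ₂ f u v = begin
    map f (lift₂ _∷_ u (lift₂ _∷_ v (η [])))               ≡⟨ map-lift₂ f _∷_ u _ ⟩
    -- The pure empty vector that ends `ψⁿ` is absorbed by the right unit law.
    lift₂ (λ a as → f (a ∷ as)) u (lift₂ _∷_ v (η []))     ≡⟨ cong₂ (lift₂ _) (sym (map-id u)) (lift₂-ηʳ _∷_ v []) ⟩
    lift₂ (λ a as → f (a ∷ as)) (map id u) (map (_∷ []) v) ≡⟨ lift₂-map _ id (_∷ []) u v ⟩
    lift₂ (λ a b → f (a ∷ b ∷ [])) u v                     ∎

  -- Contexts in the lifted delayed algebra

  module _ {P : Set ℓ} (_∙_ : P → P → P) (⋆ : P) (⋆-idem : ⋆ ∙ ⋆ ≡ ⋆) where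

    open Delay _∙_

    module _ {Σ : Signature o} {x : Var} (vs : List Side) (ρ : Var → T (Chain vs))
             (ρ-fresh : ∀ {y} → y ≢ x → ρ y ≡ η (constant vs ⋆)) {N : Term Σ Var} where

      private
        ⟦_⟧ᵀ : Term Σ Var → T (Chain vs)
        ⟦_⟧ᵀ = eval (lifting 𝕋 (delayed ⋆ Σ vs)) ρ

      eval-fresh : ∀ {t} → Fresh x t → ⟦ t [ N ] ⟧ᵀ ≡ η (constant vs ⋆)
      eval-fresh (var y≢x) = ρ-fresh y≢x
      eval-fresh (op₂ σ {s} {t} fs ft) = begin
        ⟦ app₂ σ s t [ N ] ⟧ᵀ                                        ≡⟨ map-ψⁿ₂ (interpret ⋆ vs) _ _ ⟩
        lift₂ (product vs) ⟦ s [ N ] ⟧ᵀ ⟦ t [ N ] ⟧ᵀ                 ≡⟨ cong₂ (lift₂ _) (eval-fresh fs) (eval-fresh ft) ⟩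
        lift₂ (product vs) (η (constant vs ⋆)) (η (constant vs ⋆))   ≡⟨ lift₂-ηʳ _ _ _ ⟩
        map (λ c → product vs c (constant vs ⋆)) (η (constant vs ⋆)) ≡⟨ η-natural _ _ ⟩
        η (product vs (constant vs ⋆) (constant vs ⋆))               ≡⟨ cong η (product-constant ⋆-idem vs) ⟩
        η (constant vs ⋆)                                            ∎

      -- All siblings of the path evaluate to pure values, so each lifted operation on the path
      -- reduces to `map` of a unary function.
      eval-plug : ∀ {t ws} → Linear x t ws → ⟦ t [ N ] ⟧ᵀ ≡ map (fill ⋆ vs ws) ⟦ N ⟧ᵀ
      eval-plug hole = sym (map-id _)
      eval-plug (leftᵒ σ {s} {t} {ws} ls ft) = begin
        ⟦ app₂ σ s t [ N ] ⟧ᵀ                                                ≡⟨ map-ψⁿ₂ (interpret ⋆ vs) _ _ ⟩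
        lift₂ (product vs) ⟦ s [ N ] ⟧ᵀ ⟦ t [ N ] ⟧ᵀ                         ≡⟨ cong₂ (lift₂ _) (eval-plug ls) (eval-fresh ft) ⟩
        lift₂ (product vs) (map (fill ⋆ vs ws) ⟦ N ⟧ᵀ) (η (constant vs ⋆))   ≡⟨ lift₂-ηʳ _ _ _ ⟩
        map (λ c → product vs c (constant vs ⋆)) (map (fill ⋆ vs ws) ⟦ N ⟧ᵀ) ≡⟨ map-∘ _ _ _ ⟨
        map (fill ⋆ vs (left ∷ ws)) ⟦ N ⟧ᵀ                                   ∎
      eval-plug (rightᵒ σ {s} {t} {ws} fs lt) = begin
        ⟦ app₂ σ s t [ N ] ⟧ᵀ                                              ≡⟨ map-ψⁿ₂ (interpret ⋆ vs) _ _ ⟩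
        lift₂ (product vs) ⟦ s [ N ] ⟧ᵀ ⟦ t [ N ] ⟧ᵀ                       ≡⟨ cong₂ (lift₂ _) (eval-fresh fs) (eval-plug lt) ⟩
        lift₂ (product vs) (η (constant vs ⋆)) (map (fill ⋆ vs ws) ⟦ N ⟧ᵀ) ≡⟨ lift₂-ηˡ _ _ _ ⟩
        map (product vs (constant vs ⋆)) (map (fill ⋆ vs ws) ⟦ N ⟧ᵀ)       ≡⟨ map-∘ _ _ _ ⟨
        map (fill ⋆ vs (right ∷ ws)) ⟦ N ⟧ᵀ                                ∎

  -- Idempotence of lifted operations

  module _ {Σ : Signature o} (τ : Op Σ 2) {x : Var} {t : HoleTerm Σ} {ws : List Side}
           (lin : Linear x t ws)
           (preserves : Preserves 𝕋 (t [ var x ]) (t [ app₂ τ (var x) (var x) ])) where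

    -- Taking heads in the preserved equation leaves the last entries of the two plugged values, and
    -- `bottom` turns the delayed product back into `_∙_`. The point serves as the value of the
    -- variables other than `x`.
    lift₂-idem-pointed : {P : Set ℓ} (_∙_ : P → P → P) → P → (∀ p → p ∙ p ≡ p) →
                         ∀ u → lift₂ _∙_ u u ≡ u
    lift₂-idem-pointed {P} _∙_ ⋆ idem u = begin
      lift₂ _∙_ u u                                          ≡⟨ cong₂ (lift₂ _∙_) map-bottom map-bottom ⟨
      lift₂ _∙_ (map (bottom ws) U) (map (bottom ws) U)      ≡⟨ lift₂-map _∙_ _ _ U U ⟩
      lift₂ (λ c d → bottom ws c ∙ bottom ws d) U U          ≡⟨ lift₂-cong (bottom-product ws) U U ⟨
      lift₂ (λ c d → bottom ws (product ws c d)) U U         ≡⟨ map-lift₂ _ _ U U ⟨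
      map (bottom ws) (lift₂ (product ws) U U)               ≡⟨ map-fill _ ⟨
      map head (map (fill ⋆ ws ws) (lift₂ (product ws) U U)) ≡⟨ cong (map head) plugged ⟨
      map head (map (fill ⋆ ws ws) U)                        ≡⟨ map-fill U ⟩
      map (bottom ws) U                                      ≡⟨ map-bottom ⟩
      u                                                      ∎
      where
      open Delay _∙_

      -- `constant ws` is a section of `bottom ws`, so `u` can be recovered from `U`.
      U : T (Chain ws)
      U = map (constant ws) u

      map-bottom : map (bottom ws) U ≡ u
      map-bottom = begin
        map (bottom ws) (map (constant ws) u) ≡⟨ map-∘ _ _ u ⟨
        map (bottom ws ∘ constant ws) u       ≡⟨ map-cong (bottom-constant ws) u ⟩
        map id u                              ≡⟨ map-id u ⟩
        u                                     ∎

      map-fill : ∀ v → map head (map (fill ⋆ ws ws) v) ≡ map (bottom ws) v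
      map-fill v = trans (sym (map-∘ _ _ v)) (map-cong (head-fill ⋆ ws) v)

      ρ : Var → T (Chain ws)
      ρ y with y ≟ x
      ... | yes _ = U
      ... | no  _ = η (constant ws ⋆)

      ρ-x : ρ x ≡ U
      ρ-x with x ≟ x
      ... | yes _   = refl
      ... | no  x≢x = ⊥-elim (x≢x refl)

      ρ-fresh : ∀ {y} → y ≢ x → ρ y ≡ η (constant ws ⋆)
      ρ-fresh {y} y≢x with y ≟ x
      ... | yes y≡x = ⊥-elim (y≢x y≡x)
      ... | no  _   = refl

      ⟦_⟧ᵀ : Term Σ Var → T (Chain ws)
      ⟦_⟧ᵀ = eval (lifting 𝕋 (delayed ⋆ Σ ws)) ρ

      plugged : map (fill ⋆ ws ws) U ≡ map (fill ⋆ ws ws) (lift₂ (product ws) U U)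
      plugged = begin
        map (fill ⋆ ws ws) U                                ≡⟨ cong (map _) ρ-x ⟨
        map (fill ⋆ ws ws) ⟦ var x ⟧ᵀ                       ≡⟨ eval-plug _∙_ ⋆ (idem ⋆) ws ρ ρ-fresh lin ⟨
        ⟦ t [ var x ] ⟧ᵀ                                    ≡⟨ preserves (delayed ⋆ Σ ws) (delayed-⊨ ⋆ idem τ lin) ρ ⟩
        ⟦ t [ app₂ τ (var x) (var x) ] ⟧ᵀ                   ≡⟨ eval-plug _∙_ ⋆ (idem ⋆) ws ρ ρ-fresh lin ⟩
        map (fill ⋆ ws ws) ⟦ app₂ τ (var x) (var x) ⟧ᵀ      ≡⟨ cong (map _) (map-ψⁿ₂ (interpret ⋆ ws) (ρ x) (ρ x)) ⟩
        map (fill ⋆ ws ws) (lift₂ (product ws) (ρ x) (ρ x)) ≡⟨ cong (λ v → map _ (lift₂ _ v v)) ρ-x ⟩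
        map (fill ⋆ ws ws) (lift₂ (product ws) U U)         ∎

    -- `P` may be empty, so an absorbing element `nothing` is adjoined as the point; `zipWith _∙_`
    -- stays idempotent.
    lift₂-idem : {P : Set ℓ} (_∙_ : P → P → P) → (∀ p → p ∙ p ≡ p) → ∀ u → lift₂ _∙_ u u ≡ u
    lift₂-idem _∙_ idem u = map-just-injective (begin
      map just (lift₂ _∙_ u u)                      ≡⟨ map-lift₂ just _∙_ u u ⟩
      lift₂ (λ p q → just (p ∙ q)) u u              ≡⟨ lift₂-map (zipWith _∙_) just just u u ⟨
      lift₂ (zipWith _∙_) (map just u) (map just u) ≡⟨ lift₂-idem-pointed (zipWith _∙_) nothing idem′ (map just u) ⟩
      map just u                                    ∎)
      where
      idem′ : ∀ m → zipWith _∙_ m m ≡ m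
      idem′ nothing  = refl
      idem′ (just p) = cong just (idem p)

theorem5 : ∀ {ℓ o : Level} (𝕋 : MonoidalMonad ℓ) (Σ : Signature o) (∙ : Op Σ 2)
    (x : Var) (t : HoleTerm Σ) →
    BinaryOnly t →
    nothing ∈ variables t →
    Unique (variables t) →
    just x ∉ variables t →
    Preserves 𝕋 (t [ var x ]) (t [ app₂ ∙ (var x) (var x) ]) →
    Relevant 𝕋
theorem5 𝕋 Σ ∙ x t bin ∈∙ uniq ∉x preserves u with ws , lin ← linear x bin ∈∙ uniq ∉x = begin
  ψ (map proj₁ u , map proj₂ u)           ≡⟨ map-id _ ⟨
  map id (ψ (map proj₁ u , map proj₂ u))  ≡⟨ lift₂-map 𝕋 _,_ proj₁ proj₂ u u ⟩
  -- The rectangular band is idempotent by eta for pairs.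
  lift₂ 𝕋 (λ p q → proj₁ p , proj₂ q) u u ≡⟨ lift₂-idem 𝕋 ∙ lin preserves _ (λ _ → refl) u ⟩
  u                                       ∎
  where open MonoidalMonad 𝕋
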